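{- For all positive integers $n$ and $k$, \[ |\mathrm{Hom}(P_n,P_k)| \;=\; k\cdot 2^{n-1} \;-\; \sum_{i=0}^{n-2} 2^{\,n-1-i}\sum_{j\in\mathbb Z}\left(\binom{i}{\lceil i/2\rceil - j(k+1)} - \binom{i}{\lfloor (i+k+1)/2\rfloor - j(k+1)}\right). \]
   Context: All graphs are finite, undirected, without loops or multiple edges. For a positive integer $m$, $P_m$ denotes the path with vertex set $[m]=\{1,\dots,m\}$ in which $i$ and $j$ are adjacent iff $|i-j|=1$. A homomorphism $G\to H$ is a map $f:V(G)\to V(H)$ sending adjacent vertices to adjacent vertices; $\mathrm{Hom}(G,H)$ is the set of such maps. Convention: $\binom{a}{b}=0$ if $b<0$ or $b>a$ (so each inner sum over $j$ is finite). -}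

module Defs where

open import Algebra.Properties.CommutativeMonoid.Sum as Sum using ()
open import Data.Fin.Base using (Fin; zero; suc; toℕ)
open import Data.Integer.Base
  using (ℤ; +_; -[1+_]; 0ℤ; -_; _+_; _-_; _*_; ∣_∣)
import Data.Integer.Properties as ℤₚ
open import Data.Nat.Base as ℕ using (ℕ; zero; suc; z≤n; s≤s)
open import Data.Nat.Combinatorics using (_C_)
open import Data.Nat.Combinatorics.Specification using (k>n⇒nCk≡0)
import Data.Nat.Properties as ℕₚ
open import Function.Bundles using (Inverse)
open import Level using (0ℓ)
open import Relation.Binary.Bundles using (Setoid)
open import Relation.Binary.Core using (Rel)
open import Relation.Binary.Definitions using (Symmetric)
open import Relation.Binary.PropositionalEquality
  using (_≡_; refl; sym; trans; cong; cong₂; setoid)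
open import Relation.Nullary.Negation using (¬_)

open Sum ℤₚ.+-0-commutativeMonoid public using (sum; sum-syntax)

record Graph : Set₁ where
  field
    order      : ℕ
    Adjacent   : Rel (Fin order) 0ℓ
    symmetric  : Symmetric Adjacent
    loopless   : ∀ {v} → ¬ Adjacent v v

  Vertex : Set
  Vertex = Fin order

open Graph

record Hom (G H : Graph) : Set where
  field
    map       : Vertex G → Vertex H
    preserves : ∀ {u v} → Adjacent G u v → Adjacent H (map u) (map v)

-- Homomorphisms are maps, so they are compared pointwise on vertices only.
HomSetoid : Graph → Graph → Setoid 0ℓ 0ℓ
HomSetoid G H = record
  { Carrier       = Hom G H
  ; _≈_           = λ f g → ∀ v → Hom.map f v ≡ Hom.map g v
  ; isEquivalence = record
    { refl  = λ v → refl
    ; sym   = λ p v → sym (p v)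
    ; trans = λ p q v → trans (p v) (q v)
    }
  }

HasCardinality : Setoid 0ℓ 0ℓ → ℕ → Set
HasCardinality S N = Inverse (setoid (Fin N)) S

-- The vertex v : Fin m stands for 1 + toℕ v ∈ {1,…,m}; the shift does not
-- affect differences.
P : ℕ → Graph
P m = record
  { order     = m
  ; Adjacent  = λ u v → ℕ.∣ toℕ u - toℕ v ∣ ≡ 1
  ; symmetric = λ {u} {v} p → trans (ℕₚ.∣-∣-comm (toℕ v) (toℕ u)) p
  ; loopless  = λ {v} p → ℕₚ.0≢1+n (trans (sym (ℕₚ.∣n-n∣≡0 (toℕ v))) p)
  }

-- _C_ already vanishes when the lower index exceeds the upper one.
binom : ℕ → ℤ → ℤ
binom n (+ m)    = + (n C m)
binom n -[1+ _ ] = 0ℤ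

binom-zero : ∀ n z → n ℕ.< ∣ z ∣ → binom n z ≡ 0ℤ
binom-zero n (+ m)    n<m = cong +_ (k>n⇒nCk≡0 n<m)
binom-zero n -[1+ _ ] _   = refl

record FiniteSupport (f : ℤ → ℤ) : Set where
  field
    bound    : ℕ
    vanishes : ∀ j → bound ℕ.< ∣ j ∣ → f j ≡ 0ℤ

open FiniteSupport

-- The sum of f j over -B ≤ j ≤ B.
symmetricSum : (ℤ → ℤ) → ℕ → ℤ
symmetricSum f B =
  f 0ℤ + (∑[ m < B ] (f (+ suc (toℕ m)) + f -[1+ toℕ m ]))

Σℤ : (f : ℤ → ℤ) → FiniteSupport f → ℤ
Σℤ f s = symmetricSum f (bound s)

private
  ∑-extend : ∀ B c (h : ℕ → ℤ) → (∀ m → B ℕ.≤ m → h m ≡ 0ℤ) →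
             (∑[ m < B ] h (toℕ m)) ≡ (∑[ m < B ℕ.+ c ] h (toℕ m))
  ∑-extend zero    zero    h h≡0 = refl
  ∑-extend zero    (suc c) h h≡0 =
    cong₂ _+_ (sym (h≡0 0 z≤n))
              (∑-extend zero c (λ m → h (suc m)) (λ m _ → h≡0 (suc m) z≤n))
  ∑-extend (suc B) c       h h≡0 =
    cong (_+_ (h 0)) (∑-extend B c (λ m → h (suc m)) (λ m B≤m → h≡0 (suc m) (s≤s B≤m)))

  symmetricSum-extend : ∀ f (s : FiniteSupport f) c →
                        Σℤ f s ≡ symmetricSum f (bound s ℕ.+ c)
  symmetricSum-extend f s c =
    cong (_+_ (f 0ℤ)) (∑-extend (bound s) c (λ m → f (+ suc m) + f -[1+ m ])
      λ m B≤m → cong₂ _+_ (vanishes s (+ suc m) (s≤s B≤m))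
                          (vanishes s -[1+ m ] (s≤s B≤m)))

Σℤ-irrelevant : ∀ f (s t : FiniteSupport f) → Σℤ f s ≡ Σℤ f t
Σℤ-irrelevant f s t =
  trans (symmetricSum-extend f s (bound t))
  (trans (cong (symmetricSum f) (ℕₚ.+-comm (bound s) (bound t)))
         (sym (symmetricSum-extend f t (bound s))))

binom-support : ∀ n a d .{{_ : ℕ.NonZero d}} →
                FiniteSupport (λ j → binom n (a - j * + d))
binom-support n a d = record
  { bound    = n ℕ.+ ∣ a ∣
  ; vanishes = λ j p → binom-zero n (a - j * + d)
      (ℕₚ.+-cancelʳ-< ∣ a ∣ n _ (ℕₚ.<-≤-trans p (∣j∣≤ j)))
  }
  where
  open import Data.Integer.Tactic.RingSolver using (solve-∀)

  [a-x]-a≡-x : ∀ a x → (a - x) - a ≡ - x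
  [a-x]-a≡-x = solve-∀

  ∣j∣≤ : ∀ j → ∣ j ∣ ℕ.≤ ∣ a - j * + d ∣ ℕ.+ ∣ a ∣
  ∣j∣≤ j = begin
    ∣ j ∣                            ≤⟨ ℕₚ.m≤m*n ∣ j ∣ d ⟩
    ∣ j ∣ ℕ.* d                      ≡⟨ ℤₚ.abs-* j (+ d) ⟨
    ∣ j * + d ∣                      ≡⟨ ℤₚ.∣-i∣≡∣i∣ (j * + d) ⟨
    ∣ - (j * + d) ∣                  ≡⟨ cong ∣_∣ ([a-x]-a≡-x a (j * + d)) ⟨
    ∣ (a - j * + d) - a ∣            ≤⟨ ℤₚ.∣i-j∣≤∣i∣+∣j∣ (a - j * + d) a ⟩
    ∣ a - j * + d ∣ ℕ.+ ∣ a ∣        ∎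
    where open ℕₚ.≤-Reasoning

difference-support : ∀ {f g} → FiniteSupport f → FiniteSupport g →
                     FiniteSupport (λ j → f j - g j)
difference-support s t = record
  { bound    = bound s ℕ.+ bound t
  ; vanishes = λ j p → cong₂ _-_
      (vanishes s j (ℕₚ.≤-<-trans (ℕₚ.m≤m+n _ _) p))
      (vanishes t j (ℕₚ.≤-<-trans (ℕₚ.m≤n+m _ _) p))
  }

binomDiff-support : ∀ n a b k →
  FiniteSupport (λ j → binom n (a - j * + (k ℕ.+ 1)) - binom n (b - j * + (k ℕ.+ 1)))
binomDiff-support n a b k =
  difference-support (binom-support n a (k ℕ.+ 1)) (binom-support n b (k ℕ.+ 1))
  where instance
    k+1≢0 : ℕ.NonZero (k ℕ.+ 1)
    k+1≢0 = ℕ.>-nonZero (ℕₚ.m≤n+m 1 k)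

{-# OPTIONS --safe #-}

-- Put K = k + 1, so that a walk in P_k is a walk on {0,…,K} avoiding 0 and K.
-- Since the vertices 1 and k lack one neighbour, the number W m of walks with m
-- edges satisfies W (m+1) = 2 W m − 2 E m, where E m counts the walks from 1 and,
-- by symmetry, those from k; unrolling this recursion gives the outer sum.
-- Reflection at 0 and K suggests a formula for the number of m-edge walks from x,
-- as a function vanishing at 0 whose increment from x to x + 1 is
--   T ⌊(m+x+1)/2⌋ − T ⌊(m+x+1+K)/2⌋,  T a = ∑ⱼ C(m, a − jK).
-- Pascal's rule for T is the walk recursion; T a = T (m − a) = T (a + K) makes the
-- formula vanish at K too.
module Submission where

open import Defs
import Algebra.Properties.CommutativeSemigroup as CommutativeSemigroup
import Algebra.Properties.Semiring.Sum as SemiringSum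
open import Data.Fin.Base using (Fin; zero; suc; toℕ)
open import Data.Fin.Properties using (toℕ-inject₁; toℕ-fromℕ; toℕ<n; +↔⊎)
open import Data.Bool.Base using (if_then_else_)
open import Data.Integer.Base
  using (ℤ; +_; -[1+_]; 0ℤ; 1ℤ; -_; ∣_∣; _+_; _-_; _*_)
import Data.Integer.Properties as ℤₚ
open import Data.Integer.Tactic.RingSolver using (solve-∀)
open import Data.Nat.Base as ℕ
  using (ℕ; zero; suc; z≤n; s≤s; NonZero; _^_; _∸_; ⌊_/2⌋; ⌈_/2⌉)
open import Data.Nat.Combinatorics using (_C_; nCk+nC[k+1]≡[n+1]C[k+1])
import Data.Nat.Properties as ℕₚ
open import Data.Product.Base using (Σ; ∃-syntax; _×_; _,_; proj₂)
open import Data.Sum.Base using (_⊎_; inj₁; inj₂)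
open import Data.Sum.Function.Propositional using (_⊎-↔_)
open import Data.Unit.Base using (⊤; tt)
open import Function.Base using (_∘_)
open import Function.Bundles using (Inverse; _↔_; mk↔ₛ′)
open import Function.Construct.Composition using (inverse)
open import Function.Properties.Bijection using (Bijection⇒Inverse)
open import Function.Properties.Inverse using (↔-trans)
open import Relation.Binary.PropositionalEquality
open import Relation.Nullary.Decidable using (Dec; does; yes; no)
open import Relation.Nullary.Negation using (contradiction)

open CommutativeSemigroup ℤₚ.+-commutativeSemigroup using (interchange)
open FiniteSupport
open SemiringSum ℤₚ.+-*-semiring
  using (sum-cong-≗; ∑-distrib-+; *-distribˡ-sum; sum-init-last; sum-replicate-zero)

-- Finitely supported sums over ℤ

symmetricSum-cong : ∀ {f g} → f ≗ g → symmetricSum f ≗ symmetricSum g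
symmetricSum-cong f≗g B = cong₂ _+_ (f≗g 0ℤ)
  (sum-cong-≗ {B} λ m → cong₂ _+_ (f≗g (+ suc (toℕ m))) (f≗g -[1+ toℕ m ]))

symmetricSum-+ : ∀ f g B → symmetricSum (λ j → f j + g j) B ≡ symmetricSum f B + symmetricSum g B
symmetricSum-+ f g B = begin
  (f 0ℤ + g 0ℤ) + (∑[ m < B ] ((f (+ suc (toℕ m)) + g (+ suc (toℕ m))) + (f -[1+ toℕ m ] + g -[1+ toℕ m ])))
    ≡⟨ cong (_+_ (f 0ℤ + g 0ℤ)) (sum-cong-≗ {B} λ m → interchange (f (+ suc (toℕ m))) _ _ _) ⟩
  (f 0ℤ + g 0ℤ) + (∑[ m < B ] ((f (+ suc (toℕ m)) + f -[1+ toℕ m ]) + (g (+ suc (toℕ m)) + g -[1+ toℕ m ])))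
    ≡⟨ cong (_+_ (f 0ℤ + g 0ℤ)) (∑-distrib-+ {B} _ _) ⟩
  (f 0ℤ + g 0ℤ) + ((∑[ m < B ] (f (+ suc (toℕ m)) + f -[1+ toℕ m ])) + (∑[ m < B ] (g (+ suc (toℕ m)) + g -[1+ toℕ m ])))
    ≡⟨ interchange (f 0ℤ) _ _ _ ⟩
  symmetricSum f B + symmetricSum g B ∎
  where open ≡-Reasoning

symmetricSum-neg : ∀ f B → symmetricSum (f ∘ -_) B ≡ symmetricSum f B
symmetricSum-neg f B =
  cong (_+_ (f 0ℤ)) (sum-cong-≗ {B} λ m → ℤₚ.+-comm (f -[1+ toℕ m ]) _)

sum-snoc : ∀ (h : ℕ → ℤ) n → (∑[ i < suc n ] h (toℕ i)) ≡ (∑[ i < n ] h (toℕ i)) + h n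
sum-snoc h n = trans (sum-init-last {n} (h ∘ toℕ))
  (cong₂ _+_ (sum-cong-≗ {n} λ i → cong h (toℕ-inject₁ i)) (cong h (toℕ-fromℕ n)))

symmetricSum-suc : ∀ f B →
  symmetricSum f (suc B) ≡ symmetricSum f B + (f (+ suc B) + f -[1+ B ])
symmetricSum-suc f B = trans
  (cong (_+_ (f 0ℤ)) (sum-snoc (λ m → f (+ suc m) + f -[1+ m ]) B))
  (sym (ℤₚ.+-assoc (f 0ℤ) _ _))

-- Translation moves the window from -B,...,B to 1-B,...,B+1, so only the end terms at -B and B+1
-- differ. Each is added on the side that lacks it.
symmetricSum-shift : ∀ f B →
  symmetricSum (λ j → f (+ 1 + j)) B + f (- + B) ≡ symmetricSum f B + f (+ suc B)
symmetricSum-shift f zero    = swap (f 0ℤ) (f (+ 1))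
  where
  swap : ∀ a b → (b + 0ℤ) + a ≡ (a + 0ℤ) + b
  swap = solve-∀
symmetricSum-shift f (suc B) = begin
  symmetricSum f⁺ (suc B) + f -[1+ B ]
    ≡⟨ cong (λ x → x + f -[1+ B ]) (symmetricSum-suc f⁺ B) ⟩
  (symmetricSum f⁺ B + (f (+ suc (suc B)) + f (+ 1 + -[1+ B ]))) + f -[1+ B ]
    ≡⟨ cong (λ z → (symmetricSum f⁺ B + (f (+ suc (suc B)) + f z)) + f -[1+ B ]) (1-[1+B]≡-B B) ⟩
  (symmetricSum f⁺ B + (f (+ suc (suc B)) + f (- + B))) + f -[1+ B ]
    ≡⟨ regroup (symmetricSum f⁺ B) _ _ _ ⟩
  (symmetricSum f⁺ B + f (- + B)) + (f -[1+ B ] + f (+ suc (suc B)))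
    ≡⟨ cong (λ x → x + (f -[1+ B ] + f (+ suc (suc B)))) (symmetricSum-shift f B) ⟩
  (symmetricSum f B + f (+ suc B)) + (f -[1+ B ] + f (+ suc (suc B)))
    ≡⟨ regroup′ (symmetricSum f B) _ _ _ ⟩
  (symmetricSum f B + (f (+ suc B) + f -[1+ B ])) + f (+ suc (suc B))
    ≡⟨ cong (λ x → x + f (+ suc (suc B))) (symmetricSum-suc f B) ⟨
  symmetricSum f (suc B) + f (+ suc (suc B)) ∎
  where
  open ≡-Reasoning
  f⁺ = λ j → f (+ 1 + j)

  1-[1+B]≡-B : ∀ B → + 1 + -[1+ B ] ≡ - + B
  1-[1+B]≡-B zero    = refl
  1-[1+B]≡-B (suc B) = refl

  regroup : ∀ a b c d → (a + (b + c)) + d ≡ (a + c) + (d + b)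
  regroup = solve-∀

  regroup′ : ∀ a b c d → (a + b) + (c + d) ≡ (a + (b + c)) + d
  regroup′ = solve-∀

-- With `Σℤ-irrelevant`, this brings sums with unrelated bounds to a common window.
widen : ∀ {f B} (s : FiniteSupport f) → bound s ℕ.≤ B → FiniteSupport f
widen {B = B} s s≤B = record
  { bound = B ; vanishes = λ j B<j → vanishes s j (ℕₚ.≤-<-trans s≤B B<j) }

Σℤ-+ : ∀ {f g h} (s : FiniteSupport f) (t : FiniteSupport g) (u : FiniteSupport h) →
       (∀ j → h j ≡ f j + g j) → Σℤ h u ≡ Σℤ f s + Σℤ g t
Σℤ-+ {f} {g} {h} s t u h≗f+g = begin
  Σℤ h u                                   ≡⟨ Σℤ-irrelevant h u (widen u (ℕₚ.m≤n+m (bound u) B)) ⟩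
  symmetricSum h D                         ≡⟨ symmetricSum-cong h≗f+g D ⟩
  symmetricSum (λ j → f j + g j) D         ≡⟨ symmetricSum-+ f g D ⟩
  symmetricSum f D + symmetricSum g D      ≡⟨ cong₂ _+_
    (Σℤ-irrelevant f s (widen s (ℕₚ.≤-trans (ℕₚ.m≤m+n (bound s) (bound t)) B≤D)))
    (Σℤ-irrelevant g t (widen t (ℕₚ.≤-trans (ℕₚ.m≤n+m (bound t) (bound s)) B≤D))) ⟨
  Σℤ f s + Σℤ g t                          ∎
  where
  open ≡-Reasoning
  B = bound s ℕ.+ bound t
  D = B ℕ.+ bound u
  B≤D = ℕₚ.m≤m+n B (bound u)

Σℤ-neg : ∀ {f g} (s : FiniteSupport f) (t : FiniteSupport g) →
         (∀ j → g j ≡ f (- j)) → Σℤ g t ≡ Σℤ f s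
Σℤ-neg {f} {g} s t g≗f- = begin
  Σℤ g t                  ≡⟨ Σℤ-irrelevant g t (widen t (ℕₚ.m≤n+m (bound t) (bound s))) ⟩
  symmetricSum g B        ≡⟨ symmetricSum-cong g≗f- B ⟩
  symmetricSum (f ∘ -_) B ≡⟨ symmetricSum-neg f B ⟩
  symmetricSum f B        ≡⟨ Σℤ-irrelevant f s (widen s (ℕₚ.m≤m+n (bound s) (bound t))) ⟨
  Σℤ f s                  ∎
  where
  open ≡-Reasoning
  B = bound s ℕ.+ bound t

Σℤ-shift : ∀ {f g} (s : FiniteSupport f) (t : FiniteSupport g) →
           (∀ j → g j ≡ f (+ 1 + j)) → Σℤ g t ≡ Σℤ f s
Σℤ-shift {f} {g} s t g≗f⁺ = begin
  Σℤ g t                                          ≡⟨ Σℤ-irrelevant g t (widen t t≤B) ⟩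
  symmetricSum g B                                ≡⟨ symmetricSum-cong g≗f⁺ B ⟩
  symmetricSum (λ j → f (+ 1 + j)) B              ≡⟨ ℤₚ.+-identityʳ _ ⟨
  symmetricSum (λ j → f (+ 1 + j)) B + 0ℤ         ≡⟨ cong (_+_ (symmetricSum (λ j → f (+ 1 + j)) B)) (vanishes s (- + B) s<B) ⟨
  symmetricSum (λ j → f (+ 1 + j)) B + f (- + B)  ≡⟨ symmetricSum-shift f B ⟩
  symmetricSum f B + f (+ suc B)                  ≡⟨ cong (_+_ (symmetricSum f B)) (vanishes s (+ suc B) (ℕₚ.m<n⇒m<1+n s<B)) ⟩
  symmetricSum f B + 0ℤ                           ≡⟨ ℤₚ.+-identityʳ _ ⟩
  symmetricSum f B                                ≡⟨ Σℤ-irrelevant f s (widen s (ℕₚ.<⇒≤ s<B)) ⟨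
  Σℤ f s                                          ∎
  where
  open ≡-Reasoning
  -- The successor puts -B, and not only B+1, outside the support of `f`.
  B = suc (bound s ℕ.+ bound t)
  t≤B : bound t ℕ.≤ B
  t≤B = ℕₚ.m≤n⇒m≤1+n (ℕₚ.m≤n+m (bound t) (bound s))
  s<B : bound s ℕ.< B
  s<B = s≤s (ℕₚ.m≤m+n (bound s) (bound t))

-- Sums of binomial coefficients along residue classes

binom-pascal : ∀ n z → binom (suc n) z ≡ binom n z + binom n (z - + 1)
binom-pascal n (+ zero)  = refl
binom-pascal n (+ suc m) = cong +_ (trans (sym (nCk+nC[k+1]≡[n+1]C[k+1] n m)) (ℕₚ.+-comm _ (n C suc m)))
binom-pascal n -[1+ m ]  = refl

binom-0-neg : ∀ z → binom 0 (- z) ≡ binom 0 z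
binom-0-neg (+ zero)  = refl
binom-0-neg (+ suc m) = sym (binom-zero 0 (+ suc m) (s≤s z≤n))
binom-0-neg -[1+ m ]  = binom-zero 0 (+ suc m) (s≤s z≤n)

-- Used with d = K: two shifts of the doubled index by K make one full period of the residue sum.
⌊s+2d/2⌋ : ∀ s d → ⌊ (s ℕ.+ d) ℕ.+ d /2⌋ ≡ ⌊ s /2⌋ ℕ.+ d
⌊s+2d/2⌋ s zero    = trans
  (cong ⌊_/2⌋ (trans (ℕₚ.+-identityʳ _) (ℕₚ.+-identityʳ s)))
  (sym (ℕₚ.+-identityʳ _))
⌊s+2d/2⌋ s (suc d) = begin
  ⌊ (s ℕ.+ suc d) ℕ.+ suc d /2⌋   ≡⟨ cong ⌊_/2⌋ (trans (ℕₚ.+-suc _ d) (cong (λ x → suc (x ℕ.+ d)) (ℕₚ.+-suc s d))) ⟩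
  suc ⌊ (s ℕ.+ d) ℕ.+ d /2⌋       ≡⟨ cong suc (⌊s+2d/2⌋ s d) ⟩
  suc (⌊ s /2⌋ ℕ.+ d)             ≡⟨ ℕₚ.+-suc _ d ⟨
  ⌊ s /2⌋ ℕ.+ suc d               ∎
  where open ≡-Reasoning

-- Since ⌈s/2⌉ is `⌊ suc s /2⌋` by definition, this turns a reflection a ↦ s - a into a step from s
-- to s + 1.
s-⌊s/2⌋≡⌈s/2⌉ : ∀ s → + s - + ⌊ s /2⌋ ≡ + ⌈ s /2⌉
s-⌊s/2⌋≡⌈s/2⌉ s = trans
  (cong (λ x → + x - + ⌊ s /2⌋) (sym (ℕₚ.⌊n/2⌋+⌈n/2⌉≡n s)))
  (cancel (+ ⌊ s /2⌋) (+ ⌈ s /2⌉))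
  where
  cancel : ∀ a b → (a + b) - a ≡ b
  cancel = solve-∀

module _ (k : ℕ) where

  K : ℕ
  K = k ℕ.+ 1

  instance
    K≢0 : NonZero K
    K≢0 = ℕ.>-nonZero (ℕₚ.m≤n+m 1 k)

  residueSum : ℕ → ℤ → ℤ
  residueSum n a = Σℤ (λ j → binom n (a - j * + K)) (binom-support n a K)

  residueSum-pascal : ∀ n a → residueSum (suc n) a ≡ residueSum n a + residueSum n (a - + 1)
  residueSum-pascal n a =
    Σℤ-+ (binom-support n a K) (binom-support n (a - + 1) K) (binom-support (suc n) a K) λ j →
      trans (binom-pascal n (a - j * + K))
            (cong (λ z → binom n (a - j * + K) + binom n z) (swap a (j * + K)))
    where
    swap : ∀ a x → (a - x) - + 1 ≡ (a - + 1) - x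
    swap = solve-∀

  residueSum-periodic : ∀ n a → residueSum n (a + + K) ≡ residueSum n a
  residueSum-periodic n a = sym
    (Σℤ-shift (binom-support n (a + + K) K) (binom-support n a K) λ j →
      cong (binom n) (shift a j (+ K)))
    where
    shift : ∀ a j d → a - j * d ≡ (a + d) - (+ 1 + j) * d
    shift = solve-∀

  -- In the induction, reflection swaps the two terms of Pascal's rule. For n = 0 it is the
  -- substitution j ↦ -j.
  residueSum-symmetric : ∀ n a → residueSum n (+ n - a) ≡ residueSum n a
  residueSum-symmetric zero a =
    Σℤ-neg (binom-support 0 a K) (binom-support 0 (0ℤ - a) K) λ j →
      trans (cong (binom 0) (negate a j (+ K))) (binom-0-neg (a - - j * + K))
    where
    negate : ∀ a j d → (0ℤ - a) - j * d ≡ - (a - - j * d)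
    negate = solve-∀
  residueSum-symmetric (suc n) a = begin
    residueSum (suc n) (+ suc n - a)
      ≡⟨ residueSum-pascal n (+ suc n - a) ⟩
    residueSum n (+ suc n - a) + residueSum n ((+ suc n - a) - + 1)
      ≡⟨ cong₂ (λ x y → residueSum n x + residueSum n y) (eq₁ (+ n) a) (eq₂ (+ n) a) ⟩
    residueSum n (+ n - (a - + 1)) + residueSum n (+ n - a)
      ≡⟨ cong₂ _+_ (residueSum-symmetric n (a - + 1)) (residueSum-symmetric n a) ⟩
    residueSum n (a - + 1) + residueSum n a
      ≡⟨ ℤₚ.+-comm (residueSum n (a - + 1)) (residueSum n a) ⟩
    residueSum n a + residueSum n (a - + 1)
      ≡⟨ residueSum-pascal n a ⟨
    residueSum (suc n) a ∎
    where
    open ≡-Reasoning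
    eq₁ : ∀ n a → (+ 1 + n) - a ≡ n - (a - + 1)
    eq₁ = solve-∀
    eq₂ : ∀ n a → ((+ 1 + n) - a) - + 1 ≡ n - a
    eq₂ = solve-∀

  residueSum-0 : ∀ b → b ℕ.< K → residueSum 0 (+ b) ≡ binom 0 (+ b)
  residueSum-0 b b<K = begin
    -- For 0 ≤ b < K and j ≠ 0 the index b - jK is never 0, so bound 0 suffices and only the term j
    -- = 0 is left.
    residueSum 0 (+ b)           ≡⟨ Σℤ-irrelevant _ (binom-support 0 (+ b) K) onlyZero ⟩
    binom 0 (+ b - 0ℤ * + K) + 0ℤ ≡⟨ ℤₚ.+-identityʳ _ ⟩
    binom 0 (+ b - 0ℤ * + K)     ≡⟨ cong (binom 0) (drop (+ b) (+ K)) ⟩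
    binom 0 (+ b)                ∎
    where
    open ≡-Reasoning
    drop : ∀ b d → b - 0ℤ * d ≡ b
    drop = solve-∀

    b≢jK : ∀ j → 0 ℕ.< ∣ j ∣ → + b - j * + K ≢ 0ℤ
    b≢jK j 0<j eq = ℕₚ.<⇒≱ b<K (ℕₚ.≤-trans
      (ℕₚ.m≤n*m K ∣ j ∣ {{ℕ.>-nonZero 0<j}})
      (ℕₚ.≤-reflexive (trans (sym (ℤₚ.abs-* j (+ K))) (cong ∣_∣ (sym (ℤₚ.i-j≡0⇒i≡j (+ b) (j * + K) eq))))))

    onlyZero : FiniteSupport (λ j → binom 0 (+ b - j * + K))
    onlyZero = record
      { bound    = 0
      ; vanishes = λ j 0<j → binom-zero 0 _
          (ℕₚ.n≢0⇒n>0 (b≢jK j 0<j ∘ ℤₚ.∣i∣≡0⇒i≡0))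
      }

  -- The reflection formula for walks from a given vertex

  -- In the doubled index s, Pascal's shift of a by 1 becomes a shift by 2, the distance between the
  -- neighbours x - 1 and x + 1.
  halved : ℕ → ℕ → ℤ
  halved m s = residueSum m (+ ⌊ s /2⌋)

  halved-pascal : ∀ m s → halved (suc m) (2 ℕ.+ s) ≡ halved m (2 ℕ.+ s) + halved m s
  halved-pascal m s = residueSum-pascal m (+ suc ⌊ s /2⌋)

  halved-periodic : ∀ m s → halved m ((s ℕ.+ K) ℕ.+ K) ≡ halved m s
  halved-periodic m s = trans (cong (residueSum m ∘ +_) (⌊s+2d/2⌋ s K)) (residueSum-periodic m (+ ⌊ s /2⌋))

  halved-symmetric : ∀ m → halved m (suc m) ≡ halved m m
  halved-symmetric m = trans (cong (residueSum m) (sym (s-⌊s/2⌋≡⌈s/2⌉ m))) (residueSum-symmetric m (+ ⌊ m /2⌋))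

  -- Reflection of the index at level m + K differs from reflection at level m by K, which
  -- periodicity absorbs.
  halved-symmetric-K : ∀ m → halved m (suc (m ℕ.+ K)) ≡ halved m (m ℕ.+ K)
  halved-symmetric-K m = begin
    residueSum m (+ ⌈ m ℕ.+ K /2⌉)       ≡⟨ cong (residueSum m) (s-⌊s/2⌋≡⌈s/2⌉ (m ℕ.+ K)) ⟨
    residueSum m (+ (m ℕ.+ K) - + h)     ≡⟨ cong (residueSum m) (swap (+ m) (+ K) (+ h)) ⟩
    residueSum m ((+ m - + h) + + K)     ≡⟨ residueSum-periodic m (+ m - + h) ⟩
    residueSum m (+ m - + h)             ≡⟨ residueSum-symmetric m (+ h) ⟩
    residueSum m (+ h)                   ∎
    where
    open ≡-Reasoning
    h = ⌊ m ℕ.+ K /2⌋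
    swap : ∀ m d h → (m + d) - h ≡ (m - h) + d
    swap = solve-∀

  slope : ℕ → ℕ → ℤ
  slope m s = halved m s - halved m (s ℕ.+ K)

  slope-pascal : ∀ m s → slope (suc m) (2 ℕ.+ s) ≡ slope m s + slope m (2 ℕ.+ s)
  slope-pascal m s = trans (cong₂ _-_ (halved-pascal m s) (halved-pascal m (s ℕ.+ K)))
                       (regroup (halved m (2 ℕ.+ s)) _ _ _)
    where
    regroup : ∀ a b c d → (a + b) - (c + d) ≡ (b - d) + (a - c)
    regroup = solve-∀

  -- Reflection at the barrier 0: the index s = m would be the increment from -1 to 0, and s = m + 1
  -- is the one from 0 to 1.
  slope-symmetric : ∀ m → slope m (suc m) ≡ slope m m
  slope-symmetric m = cong₂ _-_ (halved-symmetric m) (halved-symmetric-K m)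

  -- Shifting by K exchanges the two terms, because `halved m` has period 2K.
  slope-antiperiodic : ∀ m s → slope m (s ℕ.+ K) ≡ - slope m s
  slope-antiperiodic m s = trans
    (cong (_-_ (halved m (s ℕ.+ K))) (halved-periodic m s))
    (flip (halved m (s ℕ.+ K)) (halved m s))
    where
    flip : ∀ a b → a - b ≡ - (b - a)
    flip = solve-∀

  -- Vertices are numbered 1,…,k; the argument x also ranges over the boundary 0 and K.
  walkCount : ℕ → ℕ → ℤ
  walkCount m zero    = 0ℤ
  walkCount m (suc x) = walkCount m x + slope m (suc x ℕ.+ m)

  -- Induction on x: the increments of both sides agree by `slope-pascal`. At x = 0,
  -- `slope-symmetric` makes up for the missing value at -1.
  walkCount-suc : ∀ m x → walkCount (suc m) (suc x) ≡ walkCount m x + walkCount m (2 ℕ.+ x)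
  walkCount-suc m zero = begin
    0ℤ + slope (suc m) (2 ℕ.+ m)
      ≡⟨ cong (_+_ 0ℤ) (slope-pascal m m) ⟩
    0ℤ + (slope m m + slope m (2 ℕ.+ m))
      ≡⟨ cong (λ x → 0ℤ + (x + slope m (2 ℕ.+ m))) (slope-symmetric m) ⟨
    0ℤ + (slope m (suc m) + slope m (2 ℕ.+ m))
      ≡⟨ regroup (slope m (suc m)) _ ⟩
    0ℤ + ((0ℤ + slope m (suc m)) + slope m (2 ℕ.+ m)) ∎
    where
    open ≡-Reasoning
    regroup : ∀ a b → 0ℤ + (a + b) ≡ 0ℤ + ((0ℤ + a) + b)
    regroup = solve-∀
  walkCount-suc m (suc x) = begin
    walkCount (suc m) (suc x) + slope (suc m) (2 ℕ.+ (x ℕ.+ suc m))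
      ≡⟨ cong₂ _+_ (walkCount-suc m x) (cong (λ y → slope (suc m) (2 ℕ.+ y)) (ℕₚ.+-suc x m)) ⟩
    (walkCount m x + walkCount m (2 ℕ.+ x)) + slope (suc m) (2 ℕ.+ (suc x ℕ.+ m))
      ≡⟨ cong (_+_ (walkCount m x + walkCount m (2 ℕ.+ x))) (slope-pascal m (suc x ℕ.+ m)) ⟩
    (walkCount m x + walkCount m (2 ℕ.+ x)) + (slope m (suc x ℕ.+ m) + slope m (3 ℕ.+ x ℕ.+ m))
      ≡⟨ interchange (walkCount m x) _ _ _ ⟩
    walkCount m (suc x) + walkCount m (3 ℕ.+ x) ∎
    where open ≡-Reasoning

  1+k+m≡m+K : ∀ m → suc k ℕ.+ m ≡ m ℕ.+ K
  1+k+m≡m+K m = trans (cong (ℕ._+ m) (ℕₚ.+-comm 1 k)) (ℕₚ.+-comm K m)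

  -- This is the increment from k to K. It equals the increment from K to K + 1 in `slope-at-K`,
  -- which is reflection at the barrier K.
  slope-at-k : ∀ m → slope m (suc k ℕ.+ m) ≡ - slope m m
  slope-at-k m = trans (cong (slope m) (1+k+m≡m+K m)) (slope-antiperiodic m m)

  slope-at-K : ∀ m → slope m (2 ℕ.+ k ℕ.+ m) ≡ - slope m m
  slope-at-K m = begin
    slope m (2 ℕ.+ k ℕ.+ m)  ≡⟨ cong (slope m ∘ suc) (1+k+m≡m+K m) ⟩
    slope m (suc m ℕ.+ K)    ≡⟨ slope-antiperiodic m (suc m) ⟩
    - slope m (suc m)        ≡⟨ cong -_ (slope-symmetric m) ⟩
    - slope m m              ∎
    where open ≡-Reasoning

  -- The inner sum of the theorem is the value of `walkCount m` at vertex 1, since `slope m m`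
  -- equals the first increment `slope m (suc m)`.
  slope-diagonal : ∀ m →
    Σℤ (λ j → binom m (+ ⌈ m /2⌉ - j * + (k ℕ.+ 1))
              - binom m (+ ⌊ m ℕ.+ k ℕ.+ 1 /2⌋ - j * + (k ℕ.+ 1)))
       (binomDiff-support m (+ ⌈ m /2⌉) (+ ⌊ m ℕ.+ k ℕ.+ 1 /2⌋) k) ≡ slope m m
  slope-diagonal m = begin
    Σℤ _ d
      ≡⟨ isolate (Σℤ-+ d q p λ j → sym (cancel (binom m (a - j * + K)) _)) ⟩
    residueSum m a - residueSum m b
      ≡⟨ cong₂ _-_ (halved-symmetric m) (cong (λ s → residueSum m (+ ⌊ s /2⌋)) (ℕₚ.+-assoc m k 1)) ⟩
    halved m m - halved m (m ℕ.+ K) ∎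
    where
    open ≡-Reasoning
    a = + ⌈ m /2⌉
    b = + ⌊ m ℕ.+ k ℕ.+ 1 /2⌋
    p = binom-support m a K
    q = binom-support m b K
    d = binomDiff-support m a b k

    cancel : ∀ x y → (x - y) + y ≡ x
    cancel = solve-∀

    isolate : ∀ {x y z} → x ≡ y + z → y ≡ x - z
    isolate {y = y} {z} refl = sym (cancel′ y z)
      where
      cancel′ : ∀ y z → (y + z) - z ≡ y
      cancel′ = solve-∀

  -- The bounds put ⌊s/2⌋ strictly between 0 and K, where there is no multiple of K.
  halved-0-vanishes : ∀ s → 2 ℕ.≤ s → s ℕ.< K ℕ.+ K → halved 0 s ≡ 0ℤ
  halved-0-vanishes s 2≤s s<2K = trans (residueSum-0 ⌊ s /2⌋ ⌊s/2⌋<K)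
    (binom-zero 0 (+ ⌊ s /2⌋) (ℕₚ.⌊n/2⌋-mono 2≤s))
    where
    ⌊s/2⌋<K : ⌊ s /2⌋ ℕ.< K
    ⌊s/2⌋<K = ℕₚ.≰⇒> λ K≤ → ℕₚ.<⇒≱ s<2K (subst (K ℕ.+ K ℕ.≤_) (ℕₚ.⌊n/2⌋+⌈n/2⌉≡n s)
      (ℕₚ.+-mono-≤ K≤ (ℕₚ.≤-trans K≤ (ℕₚ.⌊n/2⌋≤⌈n/2⌉ s))))

  k<K : k ℕ.< K
  k<K = ℕₚ.m<m+n k (s≤s z≤n)

  -- For m = 0 the increment from 0 to 1 is 1, and all further increments up to vertex k vanish.
  walkCount-0 : ∀ x → 0 ℕ.< x → x ℕ.≤ k → walkCount 0 x ≡ 1ℤ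
  walkCount-0 (suc zero) _ 1≤k = begin
    0ℤ + (halved 0 1 - halved 0 (1 ℕ.+ K))
      ≡⟨ cong₂ (λ x y → 0ℤ + (x - y))
           (residueSum-0 0 (ℕₚ.≤-<-trans z≤n k<K))
           (halved-0-vanishes (1 ℕ.+ K) (s≤s (ℕₚ.≤-<-trans z≤n k<K)) (ℕₚ.+-monoˡ-< K (ℕₚ.≤-<-trans 1≤k k<K))) ⟩
    1ℤ ∎
    where open ≡-Reasoning
  walkCount-0 (suc (suc x)) _ 2+x≤k = begin
    walkCount 0 (suc x) + slope 0 (2 ℕ.+ x ℕ.+ 0)
      ≡⟨ cong (λ y → walkCount 0 (suc x) + slope 0 (2 ℕ.+ y)) (ℕₚ.+-identityʳ x) ⟩
    walkCount 0 (suc x) + (halved 0 (2 ℕ.+ x) - halved 0 (2 ℕ.+ x ℕ.+ K))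
      ≡⟨ cong₂ _+_ (walkCount-0 (suc x) (s≤s z≤n) (ℕₚ.<⇒≤ 2+x≤k))
           (cong₂ _-_ (halved-0-vanishes (2 ℕ.+ x) (s≤s (s≤s z≤n)) (ℕₚ.<-≤-trans 2+x<K (ℕₚ.m≤m+n K K)))
                      (halved-0-vanishes (2 ℕ.+ x ℕ.+ K) (s≤s (s≤s z≤n)) (ℕₚ.+-monoˡ-< K 2+x<K))) ⟩
    1ℤ ∎
    where
    open ≡-Reasoning
    2+x<K : 2 ℕ.+ x ℕ.< K
    2+x<K = ℕₚ.≤-<-trans 2+x≤k k<K

  -- With f = `walkCount m`, equal increments on both sides of K give f(k) + f(K+1) = 2 f(K), which
  -- is 0 by induction. For m = 0 the increment into K is minus the value at vertex 1, hence -1.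
  walkCount-boundary : 0 ℕ.< k → ∀ m → walkCount m (suc k) ≡ 0ℤ
  walkCount-boundary 0<k zero = begin
    walkCount 0 k + slope 0 (suc k ℕ.+ 0)  ≡⟨ cong₂ _+_ (walkCount-0 k 0<k ℕₚ.≤-refl) (slope-at-k 0) ⟩
    1ℤ - slope 0 0                         ≡⟨ cong (_-_ 1ℤ) (slope-symmetric 0) ⟨
    1ℤ - slope 0 1                         ≡⟨ cong (_-_ 1ℤ) (ℤₚ.+-identityˡ (slope 0 1)) ⟨
    1ℤ - walkCount 0 1                     ≡⟨ cong (_-_ 1ℤ) (walkCount-0 1 (s≤s z≤n) 0<k) ⟩
    0ℤ                                     ∎
    where open ≡-Reasoning
  walkCount-boundary 0<k (suc m) = begin
    walkCount (suc m) (suc k)                      ≡⟨ walkCount-suc m k ⟩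
    f k + (f (suc k) + slope m (2 ℕ.+ k ℕ.+ m))    ≡⟨ cong (λ x → f k + (f (suc k) + x)) (slope-at-K m) ⟩
    f k + (f (suc k) - slope m m)                  ≡⟨ cong (λ x → f k + (f (suc k) + x)) (slope-at-k m) ⟨
    f k + (f (suc k) + slope m (suc k ℕ.+ m))      ≡⟨ swap (f k) (f (suc k)) _ ⟩
    f (suc k) + f (suc k)                          ≡⟨ cong₂ _+_ f[1+k]≡0 f[1+k]≡0 ⟩
    0ℤ                                             ∎
    where
    open ≡-Reasoning
    f = walkCount m
    f[1+k]≡0 = walkCount-boundary 0<k m
    swap : ∀ a b c → a + (b + c) ≡ b + (a + c)
    swap = solve-∀

  -- The recursion for the total number of walks and its solution

  totalWalks : ℕ → ℤ
  totalWalks m = ∑[ v < k ] walkCount m (suc (toℕ v))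

  totalWalks-suc : ∀ m → totalWalks (suc m) ≡ + 2 * totalWalks m - + 2 * slope m m
  totalWalks-suc m = begin
    totalWalks (suc m)
      ≡⟨ sum-cong-≗ {k} (λ v → walkCount-suc m (toℕ v)) ⟩
    (∑[ v < k ] (f (toℕ v) + f (2 ℕ.+ toℕ v)))
      ≡⟨ ∑-distrib-+ {k} _ _ ⟩
    A + B
      -- The left neighbours run over 0,...,k-1 and the right ones over 2,...,K. Adding f(k) and
      -- f(1) completes both ranges to contain all vertices.
      ≡⟨ balance A B (f k) (f 1) ⟩
    ((A + f k) + (f 1 + B)) - (f k + f 1)
      ≡⟨ cong₂ (λ x y → (x + y) - (f k + f 1)) (sum-snoc f k) (sym (sum-snoc (f ∘ suc) k)) ⟨
    ((0ℤ + totalWalks m) + (totalWalks m + f (suc k))) - (f k + f 1)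
      -- What is left at the ends is f(K) - f(k) and -f(1), which are single slopes up to sign.
      ≡⟨ collect (totalWalks m) (f k) (slope m (suc k ℕ.+ m)) (slope m (suc m)) ⟩
    (+ 2 * totalWalks m + slope m (suc k ℕ.+ m)) - slope m (suc m)
      ≡⟨ cong₂ (λ x y → (+ 2 * totalWalks m + x) - y) (slope-at-k m) (slope-symmetric m) ⟩
    (+ 2 * totalWalks m - slope m m) - slope m m
      ≡⟨ double (totalWalks m) (slope m m) ⟩
    + 2 * totalWalks m - + 2 * slope m m ∎
    where
    open ≡-Reasoning
    f = walkCount m
    A = ∑[ v < k ] f (toℕ v)
    B = ∑[ v < k ] f (2 ℕ.+ toℕ v)
    balance : ∀ a b x y → a + b ≡ ((a + x) + (y + b)) - (x + y)
    balance = solve-∀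
    collect : ∀ t x g e → ((0ℤ + t) + (t + (x + g))) - (x + (0ℤ + e)) ≡ (+ 2 * t + g) - e
    collect = solve-∀
    double : ∀ t g → (+ 2 * t - g) - g ≡ + 2 * t - + 2 * g
    double = solve-∀

  totalWalks-closed : 0 ℕ.< k → ∀ m →
    totalWalks m ≡ + (k ℕ.* 2 ^ m) - (∑[ i < m ] (+ (2 ^ (m ∸ toℕ i)) * slope (toℕ i) (toℕ i)))
  totalWalks-closed 0<k zero = begin
    totalWalks 0         ≡⟨ sum-cong-≗ {k} (λ v → walkCount-0 (suc (toℕ v)) (s≤s z≤n) (toℕ<n v)) ⟩
    (∑[ _ < k ] 1ℤ)      ≡⟨ sum-1 k ⟩
    + k                  ≡⟨ cong +_ (ℕₚ.*-identityʳ k) ⟨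
    + (k ℕ.* 1)          ≡⟨ ℤₚ.+-identityʳ _ ⟨
    + (k ℕ.* 1) - 0ℤ     ∎
    where
    open ≡-Reasoning
    sum-1 : ∀ n → (∑[ _ < n ] 1ℤ) ≡ + n
    sum-1 zero    = refl
    sum-1 (suc n) = cong (_+_ 1ℤ) (sum-1 n)
  totalWalks-closed 0<k (suc m) = begin
    totalWalks (suc m)
      ≡⟨ totalWalks-suc m ⟩
    + 2 * totalWalks m - + 2 * slope m m
      ≡⟨ cong (λ x → + 2 * x - + 2 * slope m m) (totalWalks-closed 0<k m) ⟩
    + 2 * (+ (k ℕ.* 2 ^ m) - S) - + 2 * slope m m
      ≡⟨ expand (+ (k ℕ.* 2 ^ m)) S (slope m m) ⟩
    + 2 * + (k ℕ.* 2 ^ m) - (+ 2 * S + + 2 * slope m m)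
      ≡⟨ cong₂ _-_ leading (trans (cong₂ _+_ rest (cong (λ e → + (2 ^ e) * slope m m) (sym 1+m∸m≡1)))
           (sym (sum-snoc (λ i → + (2 ^ (suc m ∸ i)) * slope i i) m))) ⟩
    + (k ℕ.* 2 ^ suc m) - (∑[ i < suc m ] (+ (2 ^ (suc m ∸ toℕ i)) * slope (toℕ i) (toℕ i))) ∎
    where
    open ≡-Reasoning
    S = ∑[ i < m ] (+ (2 ^ (m ∸ toℕ i)) * slope (toℕ i) (toℕ i))

    expand : ∀ a s g → + 2 * (a - s) - + 2 * g ≡ + 2 * a - (+ 2 * s + + 2 * g)
    expand = solve-∀

    leading : + 2 * + (k ℕ.* 2 ^ m) ≡ + (k ℕ.* 2 ^ suc m)
    leading = trans (sym (ℤₚ.pos-* 2 (k ℕ.* 2 ^ m))) (cong +_ (trans (sym (ℕₚ.*-assoc 2 k (2 ^ m)))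
      (trans (cong (ℕ._* 2 ^ m) (ℕₚ.*-comm 2 k)) (ℕₚ.*-assoc k 2 (2 ^ m)))))

    1+m∸m≡1 : suc m ∸ m ≡ 1
    1+m∸m≡1 = ℕₚ.m+n∸n≡m 1 m

    -- Doubling raises each exponent by one. As i ≤ m, truncated subtraction commutes with the
    -- successor.
    rest : + 2 * S ≡ (∑[ i < m ] (+ (2 ^ (suc m ∸ toℕ i)) * slope (toℕ i) (toℕ i)))
    rest = trans (*-distribˡ-sum {m} (+ 2) _) (sum-cong-≗ {m} λ i →
      trans (sym (ℤₚ.*-assoc (+ 2) (+ (2 ^ (m ∸ toℕ i))) _))
            (cong (λ x → x * slope (toℕ i) (toℕ i))
              (trans (sym (ℤₚ.pos-* 2 (2 ^ (m ∸ toℕ i))))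
                     (cong (λ e → + (2 ^ e)) (sym (ℕₚ.+-∸-assoc 1 (ℕₚ.<⇒≤ (toℕ<n i))))))))

-- Counting walks

-- The cardinality is compared as an integer because the formula for it contains subtractions.
Count : Set → ℤ → Set
Count A z = ∃[ N ] (Fin N ↔ A) × + N ≡ z

count-⊤ : Count ⊤ 1ℤ
count-⊤ = 1 , mk↔ₛ′ (λ _ → tt) (λ _ → zero) (λ _ → refl) (λ { zero → refl }) , refl

count-Σ : ∀ {n} {A : Fin n → Set} {h : Fin n → ℤ} →
          (∀ u → Count (A u) (h u)) → Count (Σ (Fin n) A) (sum h)
count-Σ {zero}  _ = 0 , mk↔ₛ′ (λ ()) (λ ()) (λ ()) (λ ()) , refl
count-Σ {suc n} c with c zero | count-Σ (c ∘ suc)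
... | M , i , p | N , j , q =
  M ℕ.+ N , ↔-trans +↔⊎ (↔-trans (i ⊎-↔ j) ⊎↔Σ) , trans (ℤₚ.pos-+ M N) (cong₂ _+_ p q)
  where
  ⊎↔Σ : ∀ {n} {A : Fin (suc n) → Set} → (A zero ⊎ Σ (Fin n) (A ∘ suc)) ↔ Σ (Fin (suc n)) A
  ⊎↔Σ = mk↔ₛ′ (λ { (inj₁ a) → zero , a ; (inj₂ (u , a)) → suc u , a })
              (λ { (zero , a) → inj₁ a ; (suc u , a) → inj₂ (u , a) })
              (λ { (zero , a) → refl ; (suc u , a) → refl })
              (λ { (inj₁ a) → refl ; (inj₂ (u , a)) → refl })

-- Turns adjacency into an indicator, so that a sum over neighbours becomes a sum over all vertices.
count-guarded : ∀ {P B : Set} {z} (P? : Dec P) → (∀ (p q : P) → p ≡ q) → Count B z →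
                Count (P × B) (if does P? then z else 0ℤ)
count-guarded (yes p) P-irrelevant (N , i , eq) =
  N , ↔-trans i (mk↔ₛ′ (p ,_) proj₂ (λ (q , b) → cong (_, b) (P-irrelevant p q)) (λ _ → refl)) , eq
count-guarded (no ¬p) _ _ =
  0 , mk↔ₛ′ (λ ()) (λ (p , _) → contradiction p ¬p) (λ (p , _) → contradiction p ¬p) (λ ()) , refl

-- The default 0 stands for the missing left neighbour of the first vertex.
below : (ℕ → ℤ) → ℕ → ℤ
below h zero    = 0ℤ
below h (suc v) = h v

-- The last vertex has no right neighbour; `h n ≡ 0ℤ` allows that term to be written all the same.
-- The induction removes the first vertex of the path.
sum-neighbours : ∀ {n} (h : ℕ → ℤ) → h n ≡ 0ℤ → ∀ (v : Fin n) →
  (∑[ u < n ] (if does (ℕ.∣ toℕ v - toℕ u ∣ ℕₚ.≟ 1) then h (toℕ u) else 0ℤ))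
  ≡ below h (toℕ v) + h (suc (toℕ v))
sum-neighbours {suc zero}    h h1≡0 zero = cong (_+_ 0ℤ) (sym h1≡0)
sum-neighbours {suc (suc n)} h _    zero =
  cong (_+_ 0ℤ) (trans (cong (_+_ (h 1)) (sum-replicate-zero n)) (ℤₚ.+-identityʳ (h 1)))
sum-neighbours {suc n} h hn≡0 (suc v) =
  trans (cong (_+_ (if does (suc (toℕ v) ℕₚ.≟ 1) then h 0 else 0ℤ)) (sum-neighbours (h ∘ suc) hn≡0 v))
        (first (toℕ v))
  where
  -- The removed vertex contributes only when v = 0, exactly where `below` returned its default.
  first : ∀ v → (if does (suc v ℕₚ.≟ 1) then h 0 else 0ℤ) + (below (h ∘ suc) v + h (2 ℕ.+ v))
                ≡ h v + h (2 ℕ.+ v)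
  first zero    = cong (_+_ (h 0)) (ℤₚ.+-identityˡ (h 2))
  first (suc v) = ℤₚ.+-identityˡ _

Walk : ∀ {k} → ℕ → Fin k → Set
Walk     zero    v = ⊤
Walk {k} (suc m) v = Σ (Fin k) λ u → (ℕ.∣ toℕ v - toℕ u ∣ ≡ 1) × Walk m u

-- Splitting off the first edge gives the recursion `walkCount-suc`; `walkCount-boundary` supplies
-- the zero beyond the last vertex.
count-walks : ∀ {k} → 0 ℕ.< k → ∀ m (v : Fin k) → Count (Walk m v) (walkCount k m (suc (toℕ v)))
count-walks {k} _   zero    v = subst (Count ⊤)
  (sym (walkCount-0 k (suc (toℕ v)) (s≤s z≤n) (toℕ<n v))) count-⊤
count-walks {k} 0<k (suc m) v = subst (Count (Walk (suc m) v))
  (begin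
    (∑[ u < k ] (if does (ℕ.∣ toℕ v - toℕ u ∣ ℕₚ.≟ 1) then walkCount k m (suc (toℕ u)) else 0ℤ))
      ≡⟨ sum-neighbours (walkCount k m ∘ suc) (walkCount-boundary k 0<k m) v ⟩
    below (walkCount k m ∘ suc) (toℕ v) + walkCount k m (2 ℕ.+ toℕ v)
      ≡⟨ cong (λ x → x + walkCount k m (2 ℕ.+ toℕ v)) (below-walkCount (toℕ v)) ⟩
    walkCount k m (toℕ v) + walkCount k m (2 ℕ.+ toℕ v)
      ≡⟨ walkCount-suc k m (toℕ v) ⟨
    walkCount k (suc m) (suc (toℕ v)) ∎)
  (count-Σ λ u → count-guarded (ℕ.∣ toℕ v - toℕ u ∣ ℕₚ.≟ 1) ℕₚ.≡-irrelevant (count-walks 0<k m u))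
  where
  open ≡-Reasoning
  below-walkCount : ∀ x → below (walkCount k m ∘ suc) x ≡ walkCount k m x
  below-walkCount zero    = refl
  below-walkCount (suc x) = refl

-- Walks as homomorphisms from a path

vertices : ∀ {k} m (v : Fin k) → Walk m v → Fin (suc m) → Fin k
vertices m       v w           zero    = v
vertices (suc m) v (u , _ , w) (suc i) = vertices m u w i

vertices-adjacent : ∀ {k} m (v : Fin k) (w : Walk m v) i j → ℕ.∣ toℕ i - toℕ j ∣ ≡ 1 →
                    ℕ.∣ toℕ (vertices m v w i) - toℕ (vertices m v w j) ∣ ≡ 1
-- Every index pair not listed is at distance 0 or at least 2, so its hypothesis is absurd.
vertices-adjacent (suc m) v (u , v~u , w) zero       (suc zero) _   = v~u
vertices-adjacent (suc m) v (u , v~u , w) (suc zero) zero       _   = trans (ℕₚ.∣-∣-comm (toℕ u) (toℕ v)) v~u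
vertices-adjacent (suc m) v (u , _   , w) (suc i)    (suc j)    i~j = vertices-adjacent m u w i j i~j

-- Beyond its vertices a walk holds only equations in ℕ, and these have unique proofs.
vertices-injective : ∀ {k} m (v v′ : Fin k) w w′ → vertices m v w ≗ vertices m v′ w′ →
                     _≡_ {A = Σ (Fin k) (Walk m)} (v , w) (v′ , w′)
vertices-injective zero    v v′ w w′ eq = cong (_, tt) (eq zero)
vertices-injective (suc m) v v′ (u , a , w) (u′ , a′ , w′) eq
  with refl ← eq zero | refl ← vertices-injective m u u′ w w′ (eq ∘ suc)
  = cong (λ a → v , u , a , w) (ℕₚ.≡-irrelevant a a′)

trace : ∀ {k} m (f : Fin (suc m) → Fin k) →
        (∀ i j → ℕ.∣ toℕ i - toℕ j ∣ ≡ 1 → ℕ.∣ toℕ (f i) - toℕ (f j) ∣ ≡ 1) → Walk m (f zero)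
trace zero    f f~ = tt
trace (suc m) f f~ = f (suc zero) , f~ zero (suc zero) refl , trace m (f ∘ suc) (λ i j → f~ (suc i) (suc j))

vertices-trace : ∀ {k} m (f : Fin (suc m) → Fin k) f~ → vertices m (f zero) (trace m f f~) ≗ f
vertices-trace m       f f~ zero    = refl
vertices-trace (suc m) f f~ (suc i) = vertices-trace m (f ∘ suc) _ i

walks↔homs : ∀ m k → Inverse (setoid (Σ (Fin k) (Walk m))) (HomSetoid (P (suc m)) (P k))
walks↔homs m k = Bijection⇒Inverse record
  { to        = λ (v , w) → record
    { map       = vertices m v w
    ; preserves = λ {i} {j} → vertices-adjacent m v w i j
    }
  ; cong      = λ { refl _ → refl }
  ; bijective = (λ {(v , w)} {(v′ , w′)} → vertices-injective m v v′ w w′)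
              , λ f → (Hom.map f zero , trace m (Hom.map f) λ i j → Hom.preserves f {i} {j})
                      , λ { refl → vertices-trace m (Hom.map f) _ }
  }

theorem2 : ∀ (n k : ℕ) .{{_ : NonZero n}} .{{_ : NonZero k}} →
    ∃[ N ] HasCardinality (HomSetoid (P n) (P k)) N ×
    + N ≡ + (k ℕ.* 2 ^ (n ∸ 1))
    - (∑[ i < n ∸ 1 ]
    (+ (2 ^ (n ∸ 1 ∸ toℕ i))
    * Σℤ (λ j → binom (toℕ i) (+ ⌈ toℕ i /2⌉ - j * + (k ℕ.+ 1))
    - binom (toℕ i) (+ ⌊ toℕ i ℕ.+ k ℕ.+ 1 /2⌋ - j * + (k ℕ.+ 1)))
    (binomDiff-support (toℕ i) (+ ⌈ toℕ i /2⌉) (+ ⌊ toℕ i ℕ.+ k ℕ.+ 1 /2⌋) k)))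
-- A path on m + 1 vertices has m edges; summing over the starting vertex counts all walks.
theorem2 (suc m) k with count-Σ (count-walks (ℕ.>-nonZero⁻¹ k) m)
... | N , Fin↔walks , N≡total = N , inverse Fin↔walks (walks↔homs m k) , (begin
  + N
    ≡⟨ N≡total ⟩
  totalWalks k m
    ≡⟨ totalWalks-closed k (ℕ.>-nonZero⁻¹ k) m ⟩
  + (k ℕ.* 2 ^ m) - (∑[ i < m ] (+ (2 ^ (m ∸ toℕ i)) * slope k (toℕ i) (toℕ i)))
    ≡⟨ cong (_-_ (+ (k ℕ.* 2 ^ m)))
         (sum-cong-≗ {m} λ i → cong (_*_ (+ (2 ^ (m ∸ toℕ i)))) (slope-diagonal k (toℕ i))) ⟨
  _ ∎)
  where open ≡-Reasoning
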